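{- Let $l,w\ge2$ be integers and let $t\in\{1,2\}$. Let $h(p)=\sum_{k=l}^{wl}N_kp^k(1-p)^{wl-k}=\sum_{k=l}^{wl}P_kp^k$ be the reliability polynomial of the hammock network of length $l$, width $w$ and type $t$. Then its first coefficient is $$P_l=N_l=\mathcal B^{(t)}_{l,w},$$ the number of brick-wall lattice paths of type $t$ connecting the left and right sides of the rectangle $[0,l-1]\times[0,w-1]$.
   Context: Hammock network of length $l$, width $w$ and type $t$: it has $wl$ two-contact relays $c_{i,j}$, $0\le i\le l-1$, $0\le j\le w-1$, each joining a left end to a right end. All left ends of the relays $c_{0,j}$ are identified with the source $S$, and all right ends of the relays $c_{l-1,j}$ with the terminus $T$. For $1\le i\le l-1$ the right end of $c_{i-1,j}$ and the left end of $c_{i,j}$ are identified to a node $(i,j)$; and the nodes $(i,j)$ and $(i,j+1)$ ($0\le j\le w-2$) are moreover joined by a (perfect) wire, i.e. identified, exactly when $i+j$ is even for type $t=1$, and exactly when $i+j$ is odd for type $t=2$. Each relay is independently closed with probability $p$ and open with probability $1-p$; the network is closed if $S$ and $T$ are connected through closed relays (regarded as undirected edges). The reliability polynomial $h(p)$ is the probability that the network is closed. $N_k$ is the number of $k$-element subsets of relays such that the network is closed when exactly these relays are closed, and $P_k$ is the coefficient of $p^k$ in $h(p)$. A point $(a,b)\in\mathbf Z\times\mathbf Z$ is even (odd) if $|a|+|b|$ is even (odd). A brick-wall lattice path of type 1 (first type) is a finite sequence of points of $\mathbf Z\times\mathbf Z$ in which each consecutive step is either $(1,0)$ (from any point), or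 $(0,1)$ from an even point, or $(0,-1)$ from an odd point. Type 2 (second type) is defined in the same way with steps $(1,0)$ from any point, $(0,1)$ from an odd point, $(0,-1)$ from an even point. Paths visit no point more than once. $\mathcal B^{(t)}_{l,w}$ is the number of brick-wall lattice paths of type $t$ starting at some point $(0,\alpha)$ and ending at some point $(l-1,\beta)$, with $\alpha,\beta\in\{0,\dots,w-1\}$, staying inside $[0,l-1]\times[0,w-1]$ and using no vertical step along the left side $x=0$ (vertical steps along the right side $x=l-1$ are allowed). -}

module Defs where

open import Data.Nat.Base as ℕ using (ℕ; zero; suc; _∸_; parity)
import Data.Nat.Properties as ℕ
open import Data.Integer.Base as ℤ using (ℤ; +_; 0ℤ; 1ℤ; -1ℤ; ∣_∣)
import Data.Integer.Properties as ℤ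
open import Data.Parity.Base using (0ℙ; 1ℙ)
open import Data.Parity.Properties using () renaming (_≟_ to _≟ℙ_)
open import Data.Bool.Properties using () renaming (_≟_ to _≟ᵇ_)
open import Data.Empty using (⊥-elim)
open import Data.Fin.Base using (Fin; toℕ; combine)
import Data.Fin.Properties as Fin
open import Data.Fin.Subset as Subset using (Subset; inside; outside)
open import Data.Fin.Subset.Properties using (_∈?_)
open import Data.List.Base as List
  using (List; []; _∷_; _++_; length; map; filter; foldr; head; last; upTo;
         allFin; cartesianProduct; cartesianProductWith; deduplicate; lookup)
open import Data.List.Properties using (≡-dec)
open import Data.List.Membership.Propositional using (_∈_)
open import Data.List.Membership.Propositional.Properties
  using (∈-filter⁺; ∈-filter⁻; ∈-++⁺ˡ; ∈-++⁺ʳ; ∈-map⁺; ∈-cartesianProductWith⁺;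
         ∈-cartesianProduct⁺; ∈-allFin; ∈-upTo⁺; ∈-deduplicate⁺; ∈-deduplicate⁻;
         ∈-lookup)
open import Data.List.Relation.Unary.All as All using (All; []; _∷_; all?)
open import Data.List.Relation.Unary.Any using (here; there; index)
open import Data.List.Relation.Unary.Any.Properties using (lookup-index)
open import Data.List.Relation.Unary.Linked using (Linked; linked?)
open import Data.List.Relation.Unary.Unique.Propositional using (Unique; []; _∷_)
open import Data.List.Relation.Unary.Unique.DecPropositional using (unique?)
open import Data.List.Relation.Unary.Unique.DecPropositional.Properties
  using (deduplicate-!)
open import Data.Maybe.Base using (just)
import Data.Maybe.Properties as Maybe
open import Data.Product.Base using (Σ; ∃-syntax; _×_; _,_; proj₁; proj₂)
import Data.Product.Properties as Product
open import Data.Sum.Base using (_⊎_; inj₁; inj₂)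
open import Data.Vec.Base as Vec using ([]; _∷_)
import Data.Vec.Properties as Vec
open import Function.Base using (_∘_)
open import Relation.Binary.Construct.Closure.Equivalence as Eq using (EqClosure)
open import Relation.Binary.Construct.Closure.ReflexiveTransitive using (ε; _◅_; _◅◅_)
open import Relation.Binary.Construct.Closure.Symmetric using (fwd; bwd)
open import Relation.Binary.Definitions using (DecidableEquality)
open import Relation.Binary.PropositionalEquality
  using (_≡_; _≢_; refl; sym; trans; cong; subst)
open import Relation.Nullary using (Dec; yes; no; ¬_)
open import Relation.Nullary.Decidable using (map′; ¬?; _×-dec_; _⊎-dec_)

------------------------------------------------------------------------
-- Counting the elements satisfying a predicate

record Finite {A : Set} (P : A → Set) : Set where
  field
    elements : List A
    unique   : Unique elements
    sound    : ∀ {x} → x ∈ elements → P x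
    complete : ∀ {x} → P x → x ∈ elements

open Finite public

-- Independent of the chosen enumeration, since elements has no repetitions.
card : {A : Set} {P : A → Set} → Finite P → ℕ
card F = length (elements F)

finite : {A : Set} {P : A → Set} → DecidableEquality A → (∀ x → Dec (P x)) →
         (xs : List A) → (∀ {x} → P x → x ∈ xs) → Finite P
finite _≟_ P? xs P⇒∈ = record
  { elements = deduplicate _≟_ (filter P? xs)
  ; unique   = deduplicate-! _≟_ (filter P? xs)
  ; sound    = λ x∈ → proj₂ (∈-filter⁻ P? {xs = xs} (∈-deduplicate⁻ _≟_ (filter P? xs) x∈))
  ; complete = λ px → ∈-deduplicate⁺ _≟_ (∈-filter⁺ P? (P⇒∈ px) px)
  }

subsets : ∀ n → List (Subset n)
subsets zero    = [] ∷ []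
subsets (suc n) = map (inside ∷_) (subsets n) ++ map (outside ∷_) (subsets n)

∈-subsets : ∀ {n} (A : Subset n) → A ∈ subsets n
∈-subsets []            = here refl
∈-subsets (inside ∷ A)  = ∈-++⁺ˡ (∈-map⁺ (inside ∷_) (∈-subsets A))
∈-subsets (outside ∷ A) =
  ∈-++⁺ʳ (map (inside ∷_) (subsets _)) (∈-map⁺ (outside ∷_) (∈-subsets A))

finiteSubsets : ∀ {n} {P : Subset n → Set} → (∀ A → Dec (P A)) → Finite P
finiteSubsets P? = finite (Vec.≡-dec _≟ᵇ_) P? (subsets _) (λ {A} _ → ∈-subsets A)

-- Connectivity through a finite list of edges is decidable: x and y are
-- connected using a further edge (a , b) iff they already were, or the edge
-- links their two components.
module _ {V : Set} (_≟_ : DecidableEquality V) where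

  connected? : ∀ es x y → Dec (EqClosure (λ u v → (u , v) ∈ es) x y)
  connected? [] x y = map′ (λ { refl → ε }) to (x ≟ y)
    where
    to : ∀ {x y} → EqClosure (λ u v → (u , v) ∈ []) x y → x ≡ y
    to ε            = refl
    to (fwd () ◅ _)
    to (bwd () ◅ _)
  connected? ((a , b) ∷ es) x y =
    map′ from to (connected? es x y
      ⊎-dec ((connected? es x a ×-dec connected? es b y)
      ⊎-dec (connected? es x b ×-dec connected? es a y)))
    where
    C C⁺ : V → V → Set
    C  = EqClosure (λ u v → (u , v) ∈ es)
    C⁺ = EqClosure (λ u v → (u , v) ∈ ((a , b) ∷ es))

    Split : V → V → Set
    Split u v = C u v ⊎ (C u a × C b v) ⊎ (C u b × C a v)

    lift : ∀ {u v} → C u v → C⁺ u v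
    lift = Eq.map there

    from : ∀ {u v} → Split u v → C⁺ u v
    from (inj₁ c)               = lift c
    from (inj₂ (inj₁ (c , d))) = lift c ◅◅ (fwd (here refl) ◅ lift d)
    from (inj₂ (inj₂ (c , d))) = lift c ◅◅ (bwd (here refl) ◅ lift d)

    extend : ∀ {u v z} → C u v → Split v z → Split u z
    extend c (inj₁ d)               = inj₁ (c ◅◅ d)
    extend c (inj₂ (inj₁ (d , e))) = inj₂ (inj₁ (c ◅◅ d , e))
    extend c (inj₂ (inj₂ (d , e))) = inj₂ (inj₂ (c ◅◅ d , e))

    to : ∀ {u v} → C⁺ u v → Split u v
    to ε                      = inj₁ ε
    to (fwd (there e) ◅ c)    = extend (fwd e ◅ ε) (to c)
    to (bwd (there e) ◅ c)    = extend (bwd e ◅ ε) (to c)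
    to (fwd (here refl) ◅ c) with to c
    ... | inj₁ d               = inj₂ (inj₁ (ε , d))
    ... | inj₂ (inj₁ (_ , e)) = inj₂ (inj₁ (ε , e))
    ... | inj₂ (inj₂ (_ , e)) = inj₁ e
    to (bwd (here refl) ◅ c) with to c
    ... | inj₁ d               = inj₂ (inj₂ (ε , d))
    ... | inj₂ (inj₁ (_ , e)) = inj₁ e
    ... | inj₂ (inj₂ (_ , e)) = inj₂ (inj₂ (ε , e))

------------------------------------------------------------------------
-- Hammock networks

data NetworkType : Set where
  type1 type2 : NetworkType

WireParity : NetworkType → ℕ → Set
WireParity type1 n = parity n ≡ 0ℙ
WireParity type2 n = parity n ≡ 1ℙ

module Hammock (t : NetworkType) (l w : ℕ) where

  -- The source, the terminus, and the two ends of each relay c_{i,j},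
  -- before any identification is made.
  data End : Set where
    S T        : End
    left right : Fin l → Fin w → End

  Configuration : Set
  Configuration = Subset (w ℕ.* l)

  relay : Fin l → Fin w → Fin (w ℕ.* l)
  relay i j = combine j i

  -- The identifications of the network, together with the relays that are
  -- closed in A.  The node (i , j), for 1 ≤ i, is represented by the left end
  -- of c_{i,j}.
  data Joined (A : Configuration) : End → End → Set where
    source : ∀ {i j} → toℕ i ≡ 0 → Joined A S (left i j)
    sink   : ∀ {i j} → suc (toℕ i) ≡ l → Joined A (right i j) T
    node   : ∀ {i i′ j} → toℕ i′ ≡ suc (toℕ i) → Joined A (right i j) (left i′ j)
    wire   : ∀ {i j j′} → 1 ℕ.≤ toℕ i → toℕ j′ ≡ suc (toℕ j) →
             WireParity t (toℕ i ℕ.+ toℕ j) → Joined A (left i j) (left i j′)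
    closed : ∀ {i j} → relay i j Subset.∈ A → Joined A (left i j) (right i j)

  Closed : Configuration → Set
  Closed A = EqClosure (Joined A) S T

  _≟ᴱ_ : DecidableEquality End
  S         ≟ᴱ S           = yes refl
  S         ≟ᴱ T           = no λ ()
  S         ≟ᴱ left _ _    = no λ ()
  S         ≟ᴱ right _ _   = no λ ()
  T         ≟ᴱ S           = no λ ()
  T         ≟ᴱ T           = yes refl
  T         ≟ᴱ left _ _    = no λ ()
  T         ≟ᴱ right _ _   = no λ ()
  left _ _  ≟ᴱ S           = no λ ()
  left _ _  ≟ᴱ T           = no λ ()
  left i j  ≟ᴱ left i′ j′  =
    map′ (λ { (refl , refl) → refl }) (λ { refl → refl , refl })
      ((i Fin.≟ i′) ×-dec (j Fin.≟ j′))
  left _ _  ≟ᴱ right _ _   = no λ ()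
  right _ _ ≟ᴱ S           = no λ ()
  right _ _ ≟ᴱ T           = no λ ()
  right _ _ ≟ᴱ left _ _    = no λ ()
  right i j ≟ᴱ right i′ j′ =
    map′ (λ { (refl , refl) → refl }) (λ { refl → refl , refl })
      ((i Fin.≟ i′) ×-dec (j Fin.≟ j′))

  wireParity? : ∀ s n → Dec (WireParity s n)
  wireParity? type1 n = parity n ≟ℙ 0ℙ
  wireParity? type2 n = parity n ≟ℙ 1ℙ

  joined? : ∀ A u v → Dec (Joined A u v)
  joined? A S S                    = no λ ()
  joined? A S T                    = no λ ()
  joined? A S (left i j)           = map′ source (λ { (source p) → p }) (toℕ i ℕ.≟ 0)
  joined? A S (right _ _)          = no λ ()
  joined? A T _                    = no λ ()
  joined? A (left _ _) S           = no λ ()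
  joined? A (left _ _) T           = no λ ()
  joined? A (left i j) (left i′ j′) =
    map′ (λ { (refl , p , q , r) → wire p q r })
         (λ { (wire p q r) → refl , p , q , r })
         ((i Fin.≟ i′) ×-dec (1 ℕ.≤? toℕ i) ×-dec (toℕ j′ ℕ.≟ suc (toℕ j))
           ×-dec wireParity? t (toℕ i ℕ.+ toℕ j))
  joined? A (left i j) (right i′ j′) =
    map′ (λ { (refl , refl , p) → closed p })
         (λ { (closed p) → refl , refl , p })
         ((i Fin.≟ i′) ×-dec (j Fin.≟ j′) ×-dec (relay i j ∈? A))
  joined? A (right _ _) S          = no λ ()
  joined? A (right i j) T          =
    map′ sink (λ { (sink p) → p }) (suc (toℕ i) ℕ.≟ l)
  joined? A (right i j) (left i′ j′) =
    map′ (λ { (refl , p) → node p }) (λ { (node p) → refl , p })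
      ((j Fin.≟ j′) ×-dec (toℕ i′ ℕ.≟ suc (toℕ i)))
  joined? A (right _ _) (right _ _) = no λ ()

  ends : List End
  ends = S ∷ T ∷ cartesianProductWith left (allFin l) (allFin w)
              ++ cartesianProductWith right (allFin l) (allFin w)

  ∈-ends : ∀ u → u ∈ ends
  ∈-ends S           = here refl
  ∈-ends T           = there (here refl)
  ∈-ends (left i j)  = there (there (∈-++⁺ˡ
    (∈-cartesianProductWith⁺ left (∈-allFin i) (∈-allFin j))))
  ∈-ends (right i j) = there (there (∈-++⁺ʳ
    (cartesianProductWith left (allFin l) (allFin w))
    (∈-cartesianProductWith⁺ right (∈-allFin i) (∈-allFin j))))

  closed? : ∀ A → Dec (Closed A)
  closed? A = map′ (Eq.map (λ e → proj₂ (∈-filter⁻ P? {xs = pairs} e)))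
                   (Eq.map (λ {u} {v} e →
                      ∈-filter⁺ P? (∈-cartesianProduct⁺ (∈-ends u) (∈-ends v)) e))
                   (connected? _≟ᴱ_ (filter P? pairs) S T)
    where
    pairs : List (End × End)
    pairs = cartesianProduct ends ends

    P? : (e : End × End) → Dec (Joined A (proj₁ e) (proj₂ e))
    P? (u , v) = joined? A u v

  closedConfigurations : Finite Closed
  closedConfigurations = finiteSubsets closed?

  N : ℕ → ℕ
  N k = card (finiteSubsets (λ A → (Subset.∣ A ∣ ℕ.≟ k) ×-dec closed? A))

------------------------------------------------------------------------
-- Integer polynomials, as coefficient lists (constant term first; trailing
-- zeros are allowed, so equality is _≈_ and not _≡_)

Poly : Set
Poly = List ℤ

coeff : Poly → ℕ → ℤ
coeff []      _       = 0ℤ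
coeff (a ∷ f) zero    = a
coeff (a ∷ f) (suc k) = coeff f k

infix 4 _≈_

_≈_ : Poly → Poly → Set
f ≈ g = ∀ k → coeff f k ≡ coeff g k

infixl 6 _⊕_
infixl 7 _⊗_ _·_
infixr 8 _^_

_⊕_ : Poly → Poly → Poly
[]      ⊕ g       = g
(a ∷ f) ⊕ []      = a ∷ f
(a ∷ f) ⊕ (b ∷ g) = a ℤ.+ b ∷ f ⊕ g

_·_ : ℤ → Poly → Poly
c · f = map (c ℤ.*_) f

_⊗_ : Poly → Poly → Poly
[]      ⊗ g = []
(a ∷ f) ⊗ g = a · g ⊕ (0ℤ ∷ f ⊗ g)

one p 1-p : Poly
one = 1ℤ ∷ []
p   = 0ℤ ∷ 1ℤ ∷ []
1-p = 1ℤ ∷ -1ℤ ∷ []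

_^_ : Poly → ℕ → Poly
f ^ zero  = one
f ^ suc k = f ⊗ f ^ k

∑ : List Poly → Poly
∑ = foldr _⊕_ []

∑[_≤k≤_] : ℕ → ℕ → (ℕ → Poly) → Poly
∑[ a ≤k≤ b ] f = ∑ (map (λ i → f (a ℕ.+ i)) (upTo (suc b ∸ a)))

------------------------------------------------------------------------
-- The reliability polynomial

-- The probability that exactly the relays in A are closed.
probability : ∀ {n} → Subset n → Poly
probability []            = one
probability (inside ∷ A)  = p ⊗ probability A
probability (outside ∷ A) = 1-p ⊗ probability A

reliability : NetworkType → ℕ → ℕ → Poly
reliability t l w = ∑ (map probability (elements (Hammock.closedConfigurations t l w)))

------------------------------------------------------------------------
-- Brick-wall lattice paths

Point : Set
Point = ℤ × ℤ

EvenPoint OddPoint : Point → Set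
EvenPoint (a , b) = parity (∣ a ∣ ℕ.+ ∣ b ∣) ≡ 0ℙ
OddPoint  (a , b) = parity (∣ a ∣ ℕ.+ ∣ b ∣) ≡ 1ℙ

Move : ℤ × ℤ → Point → Point → Set
Move (u , v) (a , b) P′ = P′ ≡ (a ℤ.+ u , b ℤ.+ v)

Vertical : NetworkType → Point → Point → Set
Vertical type1 P P′ = (EvenPoint P × Move (0ℤ , 1ℤ) P P′) ⊎ (OddPoint  P × Move (0ℤ , -1ℤ) P P′)
Vertical type2 P P′ = (OddPoint  P × Move (0ℤ , 1ℤ) P P′) ⊎ (EvenPoint P × Move (0ℤ , -1ℤ) P P′)

Step : NetworkType → Point → Point → Set
Step t P P′ = Move (1ℤ , 0ℤ) P P′ ⊎ Vertical t P P′

IsBrickWallPath : NetworkType → List Point → Set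
IsBrickWallPath t ps = Linked (Step t) ps × Unique ps

InRectangle : ℕ → ℕ → Point → Set
InRectangle l w (a , b) = (0ℤ ℤ.≤ a × a ℤ.≤ + (l ∸ 1)) × (0ℤ ℤ.≤ b × b ℤ.≤ + (w ∸ 1))

-- A brick-wall path joining the left and right sides of the rectangle
-- [0,l-1] × [0,w-1] inside it, with no vertical step along x = 0.
IsCrossing : NetworkType → ℕ → ℕ → List Point → Set
IsCrossing t l w ps =
  IsBrickWallPath t ps ×
  (∃[ α ] head ps ≡ just (0ℤ , + toℕ {w} α)) ×
  (∃[ β ] last ps ≡ just (+ (l ∸ 1) , + toℕ {w} β)) ×
  All (InRectangle l w) ps ×
  Linked (λ P P′ → ¬ (proj₁ P ≡ 0ℤ × Vertical t P P′)) ps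

_≟ᴾ_ : DecidableEquality Point
_≟ᴾ_ = Product.≡-dec ℤ._≟_ ℤ._≟_

vertical? : ∀ t P P′ → Dec (Vertical t P P′)
vertical? type1 (a , b) P′ =
  ((parity (∣ a ∣ ℕ.+ ∣ b ∣) ≟ℙ 0ℙ) ×-dec (P′ ≟ᴾ _)) ⊎-dec
  ((parity (∣ a ∣ ℕ.+ ∣ b ∣) ≟ℙ 1ℙ) ×-dec (P′ ≟ᴾ _))
vertical? type2 (a , b) P′ =
  ((parity (∣ a ∣ ℕ.+ ∣ b ∣) ≟ℙ 1ℙ) ×-dec (P′ ≟ᴾ _)) ⊎-dec
  ((parity (∣ a ∣ ℕ.+ ∣ b ∣) ≟ℙ 0ℙ) ×-dec (P′ ≟ᴾ _))

isCrossing? : ∀ t l w ps → Dec (IsCrossing t l w ps)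
isCrossing? t l w ps =
  (linked? (λ P P′ → (P′ ≟ᴾ _) ⊎-dec vertical? t P P′) ps ×-dec unique? _≟ᴾ_ ps)
  ×-dec Fin.any? (λ _ → Maybe.≡-dec _≟ᴾ_ _ _)
  ×-dec Fin.any? (λ _ → Maybe.≡-dec _≟ᴾ_ _ _)
  ×-dec all? (λ { (a , b) → ((0ℤ ℤ.≤? a) ×-dec (a ℤ.≤? _))
                    ×-dec ((0ℤ ℤ.≤? b) ×-dec (b ℤ.≤? _)) }) ps
  ×-dec linked? (λ P P′ → ¬? ((proj₁ P ℤ.≟ 0ℤ) ×-dec vertical? t P P′)) ps

rectangle : ℕ → ℕ → List Point
rectangle l w =
  cartesianProduct (map +_ (upTo (suc (l ∸ 1)))) (map +_ (upTo (suc (w ∸ 1))))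

∈-rectangle : ∀ {l w P} → InRectangle l w P → P ∈ rectangle l w
∈-rectangle ((p , q) , (r , s)) = ∈-cartesianProduct⁺ (∈-side p q) (∈-side r s)
  where
  ∈-side : ∀ {a n} → 0ℤ ℤ.≤ a → a ℤ.≤ + n → a ∈ map +_ (upTo (suc n))
  ∈-side (ℤ.+≤+ _) (ℤ.+≤+ m≤n) = ∈-map⁺ +_ (∈-upTo⁺ (ℕ.s≤s m≤n))

module _ {A : Set} (xs : List A) where

  lists≤ : ℕ → List (List A)
  lists≤ zero    = [] ∷ []
  lists≤ (suc n) = [] ∷ cartesianProductWith _∷_ xs (lists≤ n)

  ∈-lists≤ : ∀ {n ys} → length ys ℕ.≤ n → All (_∈ xs) ys → ys ∈ lists≤ n
  ∈-lists≤ {zero}  {[]}     _          _        = here refl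
  ∈-lists≤ {suc n} {[]}     _          _        = here refl
  ∈-lists≤ {suc n} {y ∷ ys} (ℕ.s≤s le) (p ∷ ps) =
    there (∈-cartesianProductWith⁺ _∷_ p (∈-lists≤ le ps))

  unique-length : ∀ {ys} → Unique ys → All (_∈ xs) ys → length ys ℕ.≤ length xs
  unique-length {ys} u a = Fin.injective⇒≤ {f = position} λ {i} {j} eq →
    lookup-injective u i j (trans (lookup-index (at i))
      (trans (cong (lookup xs) eq) (sym (lookup-index (at j)))))
    where
    at : ∀ i → lookup ys i ∈ xs
    at i = All.lookup a (∈-lookup i)

    position : Fin (length ys) → Fin (length xs)
    position i = index (at i)

    lookup-injective : ∀ {zs : List A} → Unique zs → ∀ i j → lookup zs i ≡ lookup zs j → i ≡ j
    lookup-injective (_ ∷ _) Fin.zero    Fin.zero    _  = refl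
    lookup-injective (q ∷ _) Fin.zero    (Fin.suc j) eq = ⊥-elim (All.lookup q (∈-lookup j) eq)
    lookup-injective (q ∷ _) (Fin.suc i) Fin.zero    eq =
      ⊥-elim (All.lookup q (∈-lookup i) (sym eq))
    lookup-injective (_ ∷ v) (Fin.suc i) (Fin.suc j) eq = cong Fin.suc (lookup-injective v i j eq)

crossings : ∀ t l w → Finite (IsCrossing t l w)
crossings t l w = finite (≡-dec _≟ᴾ_) (isCrossing? t l w) (lists≤ points (length points))
  (λ ((_ , nonrepeated) , _ , _ , inRect , _) →
    let ∈points = All.map (∈-rectangle {l} {w}) inRect in
    ∈-lists≤ points (unique-length points nonrepeated ∈points) ∈points)
  where
  points : List Point
  points = rectangle l w

𝓑 : NetworkType → ℕ → ℕ → ℕ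
𝓑 t l w = card (crossings t l w)

{-# OPTIONS --safe #-}

-- Each column of relays is a cut, so a closed configuration has a closed relay
-- in every column, hence at least l closed relays; collecting the configurations
-- by size gives the two expansions of h and P_l = N_l.  If exactly l relays are
-- closed, one in each column, then the network is closed iff the heights of
-- consecutive closed relays are equal or joined by a wire (again by a cut, which
-- uses that the wires in a column form a matching).  Such sequences of heights
-- are exactly the heights at which brick-wall paths leave the columns: a path
-- visits at most two points of a column, since a second vertical step would undo
-- the first.
module Submission where

open import Defs
open import Data.Nat.Base as ℕ using (ℕ; zero; suc; _≤_; _<_; _*_; _∸_; z≤n; s≤s)
import Data.Nat.Properties as ℕ
open import Data.Integer.Base as ℤ using (ℤ; +_; 0ℤ; 1ℤ; -1ℤ)
import Data.Integer.Properties as ℤ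
open import Data.Integer.Tactic.RingSolver using (solve-∀)
open import Data.Bool.Base using (true; false)
open import Data.Empty using (⊥)
open import Data.Unit.Base using (⊤; tt)
open import Data.Fin.Base as Fin using (Fin; zero; suc; toℕ; fromℕ<; remQuot)
import Data.Fin.Properties as Fin
open import Data.Fin.Subset as Subset using (Subset; inside; outside)
import Data.Fin.Subset.Properties as SubsetProperties
open import Data.List.Base using (List; []; _∷_; map; filter; length; upTo; last; allFin)
open import Data.List.Properties
  using (map-∘; filter-accept; filter-reject; ∷-injective; ∷-injectiveʳ; length-map;
         length-tabulate)
open import Data.List.Membership.Propositional using (_∈_; _∉_)
open import Data.List.Membership.Propositional.Properties
  using (∈-map⁺; ∈-map⁻; ∈-upTo⁺; ∈-filter⁺; ∈-filter⁻; ∈-allFin)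
open import Data.List.Membership.DecPropositional ℕ._≟_ using (_∈?_)
open import Data.List.Relation.Unary.All as All using (All; []; _∷_)
import Data.List.Relation.Unary.All.Properties as All
open import Data.List.Relation.Unary.Any using (here; there)
open import Data.List.Relation.Unary.Linked as Linked using (Linked; [-]; _∷_)
open import Data.List.Relation.Unary.Unique.Propositional using (Unique; []; _∷_)
import Data.List.Relation.Unary.Unique.Propositional.Properties as Unique
open import Data.Maybe.Base using (just)
open import Data.Maybe.Properties using (just-injective)
open import Data.Product.Base using (∃-syntax; _×_; _,_; proj₁; proj₂; swap)
open import Data.Product.Properties using (,-injectiveˡ; ,-injectiveʳ)
open import Data.Sum.Base using (_⊎_; inj₁; inj₂) renaming (swap to ⊎-swap)
open import Data.Vec.Base as Vec using (Vec; []; _∷_; lookup; tabulate)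
import Data.Vec.Properties as Vec
open import Function.Base using (_∘_; id)
open import Relation.Binary.Construct.Closure.Equivalence using (EqClosure)
open import Relation.Binary.Construct.Closure.ReflexiveTransitive using (ε; _◅_)
open import Relation.Binary.Construct.Closure.Symmetric using (fwd; bwd)
open import Relation.Binary.PropositionalEquality
  using (_≡_; _≢_; refl; sym; trans; cong; cong₂; subst; module ≡-Reasoning)
open import Relation.Nullary using (Dec; yes; no; does; ¬_; contradiction)
open import Relation.Nullary.Decidable using (_×-dec_; _⊎-dec_; dec-true)

private
  variable
    A B : Set

-- Counting

module _ {P : A → Set} {Q : B → Set} (F : Finite P) (G : Finite Q) (R : A → B → Set)
  (total : ∀ {x} → P x → ∃[ y ] Q y × R x y)
  (injective : ∀ {x x′ y} → R x y → R x′ y → x ≡ x′) where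

  private
    -- Each listed `y` keeps a witness `x` from `xs`. A repeated value would, by `injective`, make
    -- the new head recur in the tail, which `Unique` forbids.
    image : ∀ {xs} → Unique xs → All P xs →
            ∃[ ys ] Unique ys × length xs ≡ length ys ×
            All (λ y → Q y × ∃[ x ] x ∈ xs × R x y) ys
    image []        []       = [] , [] , refl , []
    image (x∉ ∷ u) (px ∷ a) with total px | image u a
    ... | y , qy , r | ys , v , eq , b =
      y ∷ ys ,
      All.map (λ { (_ , _ , x′∈ , r′) refl → All.lookup x∉ x′∈ (injective r r′) }) b ∷ v ,
      cong suc eq ,
      (qy , _ , here refl , r) ∷ All.map (λ (q , x′ , x′∈ , r′) → q , x′ , there x′∈ , r′) b

  -- A relation in place of a function lets one correspondence serve in both directions. The chosen
  -- values are distinct, so the pigeonhole bound `unique-length` applies to them.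
  card-≤-relation : card F ≤ card G
  card-≤-relation with image (unique F) (All.tabulate (sound F))
  ... | ys , v , eq , b =
    ℕ.≤-trans (ℕ.≤-reflexive eq)
      (unique-length (elements G) v (All.map (complete G ∘ proj₁) b))

Σℤ : (A → ℤ) → List A → ℤ
Σℤ g []       = 0ℤ
Σℤ g (x ∷ xs) = g x ℤ.+ Σℤ g xs

module _ {g h : A → ℤ} where

  Σℤ-cong : ∀ {xs} → (∀ {x} → x ∈ xs → g x ≡ h x) → Σℤ g xs ≡ Σℤ h xs
  Σℤ-cong {[]}     eq = refl
  Σℤ-cong {x ∷ xs} eq = cong₂ ℤ._+_ (eq (here refl)) (Σℤ-cong (eq ∘ there))

  Σℤ-+ : ∀ xs → Σℤ (λ x → g x ℤ.+ h x) xs ≡ Σℤ g xs ℤ.+ Σℤ h xs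
  Σℤ-+ []       = refl
  Σℤ-+ (x ∷ xs) = trans (cong (ℤ._+_ (g x ℤ.+ h x)) (Σℤ-+ xs)) (interchange (g x) (h x) _ _)
    where
    interchange : ∀ a b c d → a ℤ.+ b ℤ.+ (c ℤ.+ d) ≡ a ℤ.+ c ℤ.+ (b ℤ.+ d)
    interchange = solve-∀

module _ {g : A → ℤ} where

  Σℤ-zero : ∀ {xs} → (∀ {x} → x ∈ xs → g x ≡ 0ℤ) → Σℤ g xs ≡ 0ℤ
  Σℤ-zero {[]}     eq = refl
  Σℤ-zero {x ∷ xs} eq = cong₂ ℤ._+_ (eq (here refl)) (Σℤ-zero (eq ∘ there))

  Σℤ-single : ∀ {xs m} → Unique xs → m ∈ xs →
              (∀ {x} → x ∈ xs → x ≢ m → g x ≡ 0ℤ) → Σℤ g xs ≡ g m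
  Σℤ-single {m = m} (m∉ ∷ _) (here refl) eq =
    trans (cong (ℤ._+_ (g m)) (Σℤ-zero λ x∈ → eq (there x∈) λ x≡m → All.lookup m∉ x∈ (sym x≡m)))
          (ℤ.+-identityʳ _)
  Σℤ-single (x∉ ∷ u) (there m∈) eq =
    trans (cong₂ ℤ._+_ (eq (here refl) (All.lookup x∉ m∈)) (Σℤ-single u m∈ (eq ∘ there)))
          (ℤ.+-identityˡ _)

module _ (size : A → ℕ) (G : ℕ → ℤ) {ks : List ℕ} (ks! : Unique ks) where

  multiplicity : List A → ℕ → ℕ
  multiplicity xs k = length (filter (λ x → size x ℕ.≟ k) xs)

  Σℤ-fibres : ∀ xs → All (λ x → size x ∈ ks) xs →
              Σℤ (G ∘ size) xs ≡ Σℤ (λ k → + multiplicity xs k ℤ.* G k) ks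
  Σℤ-fibres []       []       = sym (Σℤ-zero {xs = ks} λ _ → refl)
  Σℤ-fibres (x ∷ xs) (s ∷ ss) = begin
    G (size x) ℤ.+ Σℤ (G ∘ size) xs
      ≡⟨ cong₂ ℤ._+_ (sym Σδ) (Σℤ-fibres xs ss) ⟩
    Σℤ (λ k → + δ k ℤ.* G k) ks ℤ.+ Σℤ (λ k → + multiplicity xs k ℤ.* G k) ks
      ≡⟨ Σℤ-+ ks ⟨
    Σℤ (λ k → + δ k ℤ.* G k ℤ.+ + multiplicity xs k ℤ.* G k) ks
      ≡⟨ Σℤ-cong {xs = ks} (λ {k} _ → step k) ⟩
    Σℤ (λ k → + multiplicity (x ∷ xs) k ℤ.* G k) ks ∎
    where
    open ≡-Reasoning

    -- The indicator of `size x`, written as a multiplicity so that it adds to that of `xs`. By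
    -- uniqueness of `ks` its weighted sum is the single term `G (size x)`.
    δ : ℕ → ℕ
    δ k = multiplicity (x ∷ []) k

    Σδ : Σℤ (λ k → + δ k ℤ.* G k) ks ≡ G (size x)
    Σδ = trans
      (Σℤ-single ks! s λ {k} _ k≢ →
        cong (λ d → + length d ℤ.* G k) (filter-reject (λ x → size x ℕ.≟ k) (k≢ ∘ sym)))
      (trans (cong (λ d → + length d ℤ.* G (size x))
                   (filter-accept (λ y → size y ℕ.≟ size x) refl))
             (ℤ.*-identityˡ _))

    step : ∀ k → + δ k ℤ.* G k ℤ.+ + multiplicity xs k ℤ.* G k
                 ≡ + multiplicity (x ∷ xs) k ℤ.* G k
    step k = trans (sym (ℤ.*-distribʳ-+ (G k) (+ δ k) (+ multiplicity xs k)))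
                   (cong (λ m → + m ℤ.* G k) (sym multiplicity-∷))
      where
      multiplicity-∷ : multiplicity (x ∷ xs) k ≡ δ k ℕ.+ multiplicity xs k
      multiplicity-∷ with does (size x ℕ.≟ k)
      ... | true  = refl
      ... | false = refl

-- Polynomials

-- The Cauchy product of coefficient sequences. It does not see trailing zeros, which is how `_⊗_`
-- is shown to respect `_≈_`.
conv : (ℕ → ℤ) → (ℕ → ℤ) → ℕ → ℤ
conv a b zero    = a 0 ℤ.* b 0
conv a b (suc k) = a 0 ℤ.* b (suc k) ℤ.+ conv (a ∘ suc) b k

conv-cong : ∀ {a a′ b b′} → (∀ k → a k ≡ a′ k) → (∀ k → b k ≡ b′ k) →
            ∀ k → conv a b k ≡ conv a′ b′ k
conv-cong a≈ b≈ zero    = cong₂ ℤ._*_ (a≈ 0) (b≈ 0)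
conv-cong a≈ b≈ (suc k) = cong₂ ℤ._+_ (cong₂ ℤ._*_ (a≈ 0) (b≈ (suc k)))
                                      (conv-cong (a≈ ∘ suc) b≈ k)

conv-0ˡ : ∀ b k → conv (λ _ → 0ℤ) b k ≡ 0ℤ
conv-0ˡ b zero    = refl
conv-0ˡ b (suc k) = trans (ℤ.+-identityˡ _) (conv-0ˡ b k)

conv-scaleˡ : ∀ c a b k → conv (λ i → c ℤ.* a i) b k ≡ c ℤ.* conv a b k
conv-scaleˡ c a b zero    = ℤ.*-assoc c (a 0) (b 0)
conv-scaleˡ c a b (suc k) =
  trans (cong₂ ℤ._+_ (ℤ.*-assoc c (a 0) (b (suc k))) (conv-scaleˡ c (a ∘ suc) b k))
        (sym (ℤ.*-distribˡ-+ c _ _))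

coeff-⊕ : ∀ f g k → coeff (f ⊕ g) k ≡ coeff f k ℤ.+ coeff g k
coeff-⊕ []      g       k       = sym (ℤ.+-identityˡ _)
coeff-⊕ (a ∷ f) []      k       = sym (ℤ.+-identityʳ _)
coeff-⊕ (a ∷ f) (b ∷ g) zero    = refl
coeff-⊕ (a ∷ f) (b ∷ g) (suc k) = coeff-⊕ f g k

coeff-· : ∀ c f k → coeff (c · f) k ≡ c ℤ.* coeff f k
coeff-· c []      k       = sym (ℤ.*-zeroʳ c)
coeff-· c (a ∷ f) zero    = refl
coeff-· c (a ∷ f) (suc k) = coeff-· c f k

coeff-⊗ : ∀ f g k → coeff (f ⊗ g) k ≡ conv (coeff f) (coeff g) k
coeff-⊗ []      g k       = sym (conv-0ˡ (coeff g) k)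
coeff-⊗ (a ∷ f) g zero    =
  trans (coeff-⊕ (a · g) _ 0) (trans (ℤ.+-identityʳ _) (coeff-· a g 0))
coeff-⊗ (a ∷ f) g (suc k) =
  trans (coeff-⊕ (a · g) _ (suc k)) (cong₂ ℤ._+_ (coeff-· a g (suc k)) (coeff-⊗ f g k))

coeff-∑ : ∀ (F : A → Poly) xs k → coeff (∑ (map F xs)) k ≡ Σℤ (λ x → coeff (F x) k) xs
coeff-∑ F []       k = refl
coeff-∑ F (x ∷ xs) k = trans (coeff-⊕ (F x) _ k) (cong (ℤ._+_ (coeff (F x) k)) (coeff-∑ F xs k))

∷-cong : ∀ {a} f g → f ≈ g → a ∷ f ≈ a ∷ g
∷-cong f g f≈g zero    = refl
∷-cong f g f≈g (suc k) = f≈g k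

⊗-cong : ∀ f f′ g g′ → f ≈ f′ → g ≈ g′ → f ⊗ g ≈ f′ ⊗ g′
⊗-cong f f′ g g′ f≈ g≈ k =
  trans (coeff-⊗ f g k) (trans (conv-cong f≈ g≈ k) (sym (coeff-⊗ f′ g′ k)))

coeff-·⊗ : ∀ c f g k → coeff (c · f ⊗ g) k ≡ c ℤ.* coeff (f ⊗ g) k
coeff-·⊗ c f g k =
  trans (coeff-⊗ (c · f) g k)
  (trans (conv-cong {b = coeff g} (coeff-· c f) (λ _ → refl) k)
  (trans (conv-scaleˡ c (coeff f) (coeff g) k)
         (cong (ℤ._*_ c) (sym (coeff-⊗ f g k)))))

one⊗ : ∀ g → one ⊗ g ≈ g
one⊗ g zero    = trans (coeff-⊗ one g 0) (ℤ.*-identityˡ _)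
one⊗ g (suc k) = trans (coeff-⊗ one g (suc k))
  (trans (cong₂ ℤ._+_ (ℤ.*-identityˡ (coeff g (suc k))) (conv-0ˡ (coeff g) k)) (ℤ.+-identityʳ _))

0∷⊗ : ∀ f g → (0ℤ ∷ f) ⊗ g ≈ 0ℤ ∷ (f ⊗ g)
0∷⊗ f g zero    = coeff-⊗ (0ℤ ∷ f) g 0
0∷⊗ f g (suc k) = trans (coeff-⊗ (0ℤ ∷ f) g (suc k))
  (trans (ℤ.+-identityˡ _) (sym (coeff-⊗ f g k)))

p⊗ : ∀ f → p ⊗ f ≈ 0ℤ ∷ f
p⊗ f k = trans (0∷⊗ one f k) (∷-cong (one ⊗ f) f (one⊗ f) k)

1-p⊗-zero : ∀ f → coeff (1-p ⊗ f) 0 ≡ coeff f 0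
1-p⊗-zero f = trans (coeff-⊗ 1-p f 0) (ℤ.*-identityˡ _)

1-p⊗-suc : ∀ f k → coeff (1-p ⊗ f) (suc k) ≡ coeff f (suc k) ℤ.- coeff f k
1-p⊗-suc f k = trans (coeff-⊗ 1-p f (suc k))
  (cong₂ ℤ._+_ (ℤ.*-identityˡ (coeff f (suc k))) (tail k))
  where
  tail : ∀ k → conv (λ i → coeff 1-p (suc i)) (coeff f) k ≡ ℤ.- coeff f k
  tail zero    = ℤ.-1*i≡-i _
  tail (suc k) =
    trans (cong₂ ℤ._+_ (ℤ.-1*i≡-i (coeff f (suc k))) (conv-0ˡ (coeff f) k)) (ℤ.+-identityʳ _)

1-p⊗0∷ : ∀ f → 1-p ⊗ (0ℤ ∷ f) ≈ 0ℤ ∷ (1-p ⊗ f)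
1-p⊗0∷ f zero          = 1-p⊗-zero (0ℤ ∷ f)
1-p⊗0∷ f (suc zero)    = trans (1-p⊗-suc (0ℤ ∷ f) 0)
  (trans (ℤ.+-identityʳ _) (sym (1-p⊗-zero f)))
1-p⊗0∷ f (suc (suc k)) = trans (1-p⊗-suc (0ℤ ∷ f) (suc k)) (sym (1-p⊗-suc f k))

-- Multiplication by `p ^ k` (see `p^⊗`), in a form whose lowest coefficients are literally zero.
shift : ℕ → Poly → Poly
shift zero    f = f
shift (suc k) f = 0ℤ ∷ shift k f

p^⊗ : ∀ k g → p ^ k ⊗ g ≈ shift k g
p^⊗ zero    g j = one⊗ g j
p^⊗ (suc k) g j =
  trans (⊗-cong (p ^ suc k) (0ℤ ∷ p ^ k) g g (p⊗ (p ^ k)) (λ _ → refl) j)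
  (trans (0∷⊗ (p ^ k) g j) (∷-cong (p ^ k ⊗ g) (shift k g) (p^⊗ k g) j))

1-p⊗shift : ∀ k f → 1-p ⊗ shift k f ≈ shift k (1-p ⊗ f)
1-p⊗shift zero    f j = refl
1-p⊗shift (suc k) f j = trans (1-p⊗0∷ (shift k f) j) (∷-cong _ _ (1-p⊗shift k f) j)

-- The probability depends on the size alone: every closed relay adds one shift, and every open one
-- a factor `1-p`, which commutes with shifts.
probability-≈ : ∀ {n} (A : Subset n) →
                probability A ≈ shift Subset.∣ A ∣ (1-p ^ (n ∸ Subset.∣ A ∣))
probability-≈ [] j = refl
probability-≈ (inside ∷ A) j =
  trans (p⊗ (probability A) j) (∷-cong (probability A) _ (probability-≈ A) j)
probability-≈ {suc n} (outside ∷ A) j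
  -- As `∣ A ∣` is at most `n`, the truncated difference `suc n ∸ ∣ A ∣` is `suc (n ∸ ∣ A ∣)`, which
  -- exposes the extra factor `1-p`.
  rewrite ℕ.+-∸-assoc 1 (SubsetProperties.∣p∣≤n A) =
  trans (⊗-cong 1-p 1-p (probability A) (shift Subset.∣ A ∣ (1-p ^ (n ∸ Subset.∣ A ∣)))
                (λ _ → refl) (probability-≈ A) j)
        (1-p⊗shift Subset.∣ A ∣ (1-p ^ (n ∸ Subset.∣ A ∣)) j)

shift-< : ∀ {k j} f → j < k → coeff (shift k f) j ≡ 0ℤ
shift-< {suc k} {zero}  f _         = refl
shift-< {suc k} {suc j} f (s≤s j<k) = shift-< f j<k

shift-≡ : ∀ k f → coeff (shift k f) k ≡ coeff f 0
shift-≡ zero    f = refl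
shift-≡ (suc k) f = shift-≡ k f

shift-> : ∀ k m f → (∀ j → m < j → coeff f j ≡ 0ℤ) →
          ∀ j → k ℕ.+ m < j → coeff (shift k f) j ≡ 0ℤ
shift-> zero    m f eq j       lt       = eq j lt
shift-> (suc k) m f eq (suc j) (s≤s lt) = shift-> k m f eq j lt

1-p^-zero : ∀ m → coeff (1-p ^ m) 0 ≡ 1ℤ
1-p^-zero zero    = refl
1-p^-zero (suc m) = trans (1-p⊗-zero (1-p ^ m)) (1-p^-zero m)

1-p^-degree : ∀ m j → m < j → coeff (1-p ^ m) j ≡ 0ℤ
1-p^-degree zero    (suc j) _        = refl
1-p^-degree (suc m) (suc j) (s≤s lt) = trans (1-p⊗-suc (1-p ^ m) j)
  (cong₂ ℤ._-_ (1-p^-degree m (suc j) (ℕ.m<n⇒m<1+n lt)) (1-p^-degree m j lt))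

p^-≡ : ∀ k → coeff (p ^ k) k ≡ 1ℤ
p^-≡ zero    = refl
p^-≡ (suc k) = trans (p⊗ (p ^ k) (suc k)) (p^-≡ k)

p^-≢ : ∀ {k j} → k ≢ j → coeff (p ^ k) j ≡ 0ℤ
p^-≢ {zero}  {zero}  k≢j = contradiction refl k≢j
p^-≢ {zero}  {suc j} k≢j = refl
p^-≢ {suc k} {zero}  k≢j = p⊗ (p ^ k) 0
p^-≢ {suc k} {suc j} k≢j = trans (p⊗ (p ^ k) (suc j)) (p^-≢ (k≢j ∘ cong suc))

interval : ℕ → ℕ → List ℕ
interval a b = map (a ℕ.+_) (upTo (suc b ∸ a))

interval-unique : ∀ a b → Unique (interval a b)
interval-unique a b = Unique.map⁺ (ℕ.+-cancelˡ-≡ a _ _) (Unique.upTo⁺ _)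

∈-interval⁺ : ∀ {a b k} → a ≤ k → k ≤ b → k ∈ interval a b
∈-interval⁺ {a} {b} {k} a≤k k≤b =
  subst (_∈ interval a b) (ℕ.m+[n∸m]≡n a≤k)
    (∈-map⁺ (a ℕ.+_) (∈-upTo⁺ (ℕ.∸-monoˡ-< (s≤s k≤b) a≤k)))

∈-interval⇒≥ : ∀ {a b k} → k ∈ interval a b → a ≤ k
∈-interval⇒≥ {a} k∈ with i , _ , refl ← ∈-map⁻ (a ℕ.+_) k∈ = ℕ.m≤m+n a i

coeff-∑-interval : ∀ a b (F : ℕ → Poly) j →
                   coeff (∑[ a ≤k≤ b ] F) j ≡ Σℤ (λ k → coeff (F k) j) (interval a b)
coeff-∑-interval a b F j =
  trans (cong (λ fs → coeff (∑ fs) j) (map-∘ (upTo (suc b ∸ a)))) (coeff-∑ F (interval a b) j)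

-- Two expansions of the reliability polynomial and its first coefficient

module FirstCoefficient (t : NetworkType) (l w : ℕ)
  (l≤size : ∀ {X} → Hammock.Closed t l w X → l ≤ Subset.∣ X ∣) (l≤wl : l ≤ w * l) where

  open Hammock t l w

  private
    h : Poly
    h = reliability t l w

    n : ℕ
    n = w * l

    b : ℕ → Poly
    b k = shift k (1-p ^ (n ∸ k))

    ks : List ℕ
    ks = interval l n

    Xs : List Configuration
    Xs = elements closedConfigurations

  size∈ks : ∀ {X} → X ∈ Xs → Subset.∣ X ∣ ∈ ks
  size∈ks {X} X∈ = ∈-interval⁺ (l≤size (sound closedConfigurations X∈)) (SubsetProperties.∣p∣≤n X)

  -- Selecting by size after closedness and selecting by both at once give two enumerations of one
  -- set; the relation `_≡_` compares their lengths.
  N-multiplicity : ∀ k → length (filter (λ X → Subset.∣ X ∣ ℕ.≟ k) Xs) ≡ N k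
  N-multiplicity k = ℕ.≤-antisym
    (card-≤-relation F G _≡_ (λ q → _ , swap q , refl) λ { refl refl → refl })
    (card-≤-relation G F _≡_ (λ q → _ , swap q , refl) λ { refl refl → refl })
    where
    ofSize? = λ (X : Configuration) → Subset.∣ X ∣ ℕ.≟ k

    F : Finite (λ X → Closed X × Subset.∣ X ∣ ≡ k)
    F = record
      { elements = filter ofSize? Xs
      ; unique   = Unique.filter⁺ ofSize? (unique closedConfigurations)
      ; sound    = λ X∈ → let X∈′ , eq = ∈-filter⁻ ofSize? {xs = Xs} X∈ in
                          sound closedConfigurations X∈′ , eq
      ; complete = λ (c , eq) → ∈-filter⁺ ofSize? (complete closedConfigurations c) eq
      }

    G : Finite (λ X → Subset.∣ X ∣ ≡ k × Closed X)
    G = finiteSubsets _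

  coeff-h : ∀ j → coeff h j ≡ Σℤ (λ X → coeff (b Subset.∣ X ∣) j) Xs
  coeff-h j = trans (coeff-∑ probability Xs j) (Σℤ-cong {xs = Xs} λ {X} _ → probability-≈ X j)

  coeff-h-N : ∀ j → coeff h j ≡ Σℤ (λ k → + N k ℤ.* coeff (b k) j) ks
  coeff-h-N j = trans (coeff-h j)
    (trans (Σℤ-fibres (Subset.∣_∣) (λ k → coeff (b k) j) (interval-unique l n) Xs
             (All.tabulate size∈ks))
           (Σℤ-cong {xs = ks} λ {k} _ →
             cong (λ m → + m ℤ.* coeff (b k) j) (N-multiplicity k)))

  coeff-h-outside : ∀ {j} → j ∉ ks → coeff h j ≡ 0ℤ
  coeff-h-outside {j} j∉ = trans (coeff-h j) (Σℤ-zero {xs = Xs} vanishes)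
    where
    vanishes : ∀ {X} → X ∈ Xs → coeff (b Subset.∣ X ∣) j ≡ 0ℤ
    vanishes {X} X∈ with Subset.∣ X ∣ ℕ.≤? j
    ... | no  ≰ = shift-< _ (ℕ.≰⇒> ≰)
    -- Here `j` is at least `l`, so being outside `ks` it exceeds `n`, whereas the term has degree
    -- at most `∣ X ∣ + (n ∸ ∣ X ∣) = n`.
    ... | yes ≤ = shift-> Subset.∣ X ∣ (n ∸ Subset.∣ X ∣) _ (1-p^-degree _) j
      (subst (_< j) (sym (ℕ.m+[n∸m]≡n (SubsetProperties.∣p∣≤n X)))
        (ℕ.≰⇒> λ j≤n → j∉ (∈-interval⁺ (ℕ.≤-trans (∈-interval⇒≥ (size∈ks X∈)) ≤) j≤n)))

  h≈∑N : h ≈ ∑[ l ≤k≤ n ] (λ k → + N k · p ^ k ⊗ 1-p ^ (n ∸ k))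
  h≈∑N j = trans (coeff-h-N j) (sym
    (trans (coeff-∑-interval l n (λ k → + N k · p ^ k ⊗ 1-p ^ (n ∸ k)) j)
           (Σℤ-cong {xs = ks} λ {k} _ →
             trans (coeff-·⊗ (+ N k) (p ^ k) (1-p ^ (n ∸ k)) j)
                   (cong (ℤ._*_ (+ N k)) (p^⊗ k (1-p ^ (n ∸ k)) j)))))

  -- Only the range of summation needs an argument: coefficients with index outside it vanish by
  -- `coeff-h-outside`.
  h≈∑P : h ≈ ∑[ l ≤k≤ n ] (λ k → coeff h k · p ^ k)
  h≈∑P j = sym (trans (coeff-∑-interval l n (λ k → coeff h k · p ^ k) j)
                (trans (Σℤ-cong {xs = ks} λ {k} _ → coeff-· (coeff h k) (p ^ k) j) select))
    where
    off : ∀ {k} → k ≢ j → coeff h k ℤ.* coeff (p ^ k) j ≡ 0ℤ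
    off {k} k≢j = trans (cong (ℤ._*_ (coeff h k)) (p^-≢ k≢j)) (ℤ.*-zeroʳ (coeff h k))

    select : Σℤ (λ k → coeff h k ℤ.* coeff (p ^ k) j) ks ≡ coeff h j
    select with j ∈? ks
    ... | yes j∈ = trans (Σℤ-single (interval-unique l n) j∈ λ _ → off)
                         (trans (cong (ℤ._*_ (coeff h j)) (p^-≡ j)) (ℤ.*-identityʳ _))
    ... | no  j∉ = trans (Σℤ-zero {xs = ks} λ { k∈ → off λ { refl → j∉ k∈ } })
                         (sym (coeff-h-outside j∉))

  -- Terms with `k` above `l` start beyond `p ^ l`, and the term `k = l` contributes the constant
  -- coefficient 1 of `1-p ^ (n ∸ l)`.
  Pₗ≡Nₗ : coeff h l ≡ + N l
  Pₗ≡Nₗ = trans (coeff-h-N l) (trans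
    (Σℤ-single (interval-unique l n) (∈-interval⁺ ℕ.≤-refl l≤wl) λ {k} k∈ k≢l →
      trans (cong (ℤ._*_ (+ N k)) (shift-< _ (ℕ.≤∧≢⇒< (∈-interval⇒≥ k∈) (k≢l ∘ sym))))
            (ℤ.*-zeroʳ (+ N k)))
    (trans (cong (ℤ._*_ (+ N l)) (trans (shift-≡ l _) (1-p^-zero (n ∸ l)))) (ℤ.*-identityʳ _)))

-- Listing the members of a subset

members : ∀ {n} → Subset n → List (Fin n)
members []            = []
members (inside ∷ X)  = zero ∷ map suc (members X)
members (outside ∷ X) = map suc (members X)

length-members : ∀ {n} (X : Subset n) → length (members X) ≡ Subset.∣ X ∣
length-members []            = refl
length-members (inside ∷ X)  = cong suc (trans (length-map suc (members X)) (length-members X))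
length-members (outside ∷ X) = trans (length-map suc (members X)) (length-members X)

members-unique : ∀ {n} (X : Subset n) → Unique (members X)
members-unique []            = []
members-unique (inside ∷ X)  =
  All.map⁺ (All.tabulate λ _ ()) ∷ Unique.map⁺ Fin.suc-injective (members-unique X)
members-unique (outside ∷ X) = Unique.map⁺ Fin.suc-injective (members-unique X)

∈-members⁺ : ∀ {n} {X : Subset n} {i} → i Subset.∈ X → i ∈ members X
∈-members⁺ {X = inside ∷ X}  Vec.here      = here refl
∈-members⁺ {X = inside ∷ X}  (Vec.there i∈) = there (∈-map⁺ suc (∈-members⁺ i∈))
∈-members⁺ {X = outside ∷ X} (Vec.there i∈) = ∈-map⁺ suc (∈-members⁺ i∈)

∈-members⁻ : ∀ {n} {X : Subset n} {i} → i ∈ members X → i Subset.∈ X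
∈-members⁻ {X = inside ∷ X}  (here refl) = Vec.here
∈-members⁻ {X = inside ∷ X}  (there i∈) with _ , j∈ , refl ← ∈-map⁻ suc i∈ =
  Vec.there (∈-members⁻ j∈)
∈-members⁻ {X = outside ∷ X} i∈ with _ , j∈ , refl ← ∈-map⁻ suc i∈ =
  Vec.there (∈-members⁻ j∈)

-- Wires

-- Lets both types be treated at once: a vertical step goes up from the points with `WireParity t`
-- and down from those with `WireParity (opposite t)`.
opposite : NetworkType → NetworkType
opposite type1 = type2
opposite type2 = type1

wireParity-suc⁺ : ∀ t n → WireParity t n → WireParity (opposite t) (suc n)
wireParity-suc⁺ type1 0             _ = refl
wireParity-suc⁺ type2 1             _ = refl
wireParity-suc⁺ type1 (suc (suc n)) q = wireParity-suc⁺ type1 n q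
wireParity-suc⁺ type2 (suc (suc n)) q = wireParity-suc⁺ type2 n q

wireParity-suc⁻ : ∀ t n → WireParity (opposite t) (suc n) → WireParity t n
wireParity-suc⁻ type1 0             _ = refl
wireParity-suc⁻ type2 1             _ = refl
wireParity-suc⁻ type1 (suc (suc n)) q = wireParity-suc⁻ type1 n q
wireParity-suc⁻ type2 (suc (suc n)) q = wireParity-suc⁻ type2 n q

wireParity-disjoint : ∀ t {n} → WireParity t n → ¬ WireParity (opposite t) n
wireParity-disjoint type1 even odd with () ← trans (sym even) odd
wireParity-disjoint type2 odd even with () ← trans (sym even) odd

module Wires (t : NetworkType) {w : ℕ} (i : ℕ) where

  Wired Adjacent Near : Fin w → Fin w → Set
  Wired j k    = toℕ k ≡ suc (toℕ j) × WireParity t (i ℕ.+ toℕ j)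
  Adjacent j k = Wired j k ⊎ Wired k j
  Near j k     = j ≡ k ⊎ Adjacent j k

  near? : ∀ j k → Dec (Near j k)
  near? j k = (j Fin.≟ k) ⊎-dec (wired? j k ⊎-dec wired? k j)
    where
    wired? : ∀ j k → Dec (Wired j k)
    wired? j k = (toℕ k ℕ.≟ suc (toℕ j)) ×-dec Hammock.wireParity? t 0 w t (i ℕ.+ toℕ j)

  -- The heights `j` and `k` differ by one, so `i + j` and `i + k` have opposite parities, and only
  -- one of the two nodes can be the lower end of a wire.
  wired-chain : ∀ {j k m} → Wired j k → ¬ Wired k m
  wired-chain {j} (k≡ , q) (_ , q′) = wireParity-disjoint t q′
    (subst (λ k → WireParity (opposite t) k)
      (sym (trans (cong (i ℕ.+_) k≡) (ℕ.+-suc i (toℕ j)))) (wireParity-suc⁺ t _ q))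

  -- The wires of a column form a matching: two of them at one node in the same direction have the
  -- same other end, and in opposite directions they would form a chain.
  adjacent-functional : ∀ {j k k′} → Adjacent j k → Adjacent j k′ → k ≡ k′
  adjacent-functional (inj₁ (k≡ , _)) (inj₁ (k′≡ , _)) = Fin.toℕ-injective (trans k≡ (sym k′≡))
  adjacent-functional (inj₂ (j≡ , _)) (inj₂ (j≡′ , _)) =
    Fin.toℕ-injective (ℕ.suc-injective (trans (sym j≡) j≡′))
  adjacent-functional (inj₁ a) (inj₂ b) = contradiction a (wired-chain b)
  adjacent-functional (inj₂ a) (inj₁ b) = contradiction b (wired-chain a)

  adjacent-irrefl : ∀ {j} → ¬ Adjacent j j
  adjacent-irrefl (inj₁ (eq , _)) = ℕ.1+n≢n (sym eq)
  adjacent-irrefl (inj₂ (eq , _)) = ℕ.1+n≢n (sym eq)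

  -- By the matching property, `Near a` is a whole wire component of the column, hence admissible as
  -- part of one side of a cut.
  near-adjacent : ∀ {a j k} → Near a j → Adjacent j k → Near a k
  near-adjacent (inj₁ refl) b = inj₂ b
  near-adjacent (inj₂ a)    b = inj₁ (adjacent-functional (⊎-swap a) b)

-- Brick-wall paths

module Paths (t : NetworkType) (w : ℕ) where

  open Wires t {w}

  -- The element of `Fin n` excludes `n = 0`, where `n ∸ 1` is truncated and the bound fails.
  ≤∸1⇒< : ∀ {n m} → Fin n → m ≤ n ∸ 1 → m < n
  ≤∸1⇒< {suc n} _ m≤n = s≤s m≤n

  point : ℕ → Fin w → Point
  point i j = + i , + toℕ j

  point-injectiveʳ : ∀ {i i′ j k} → point i j ≡ point i′ k → j ≡ k
  point-injectiveʳ eq = Fin.toℕ-injective (ℤ.+-injective (,-injectiveʳ eq))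

  move-up : ∀ {i j k} → toℕ k ≡ suc (toℕ j) → Move (0ℤ , 1ℤ) (point i j) (point i k)
  move-up {i} {j} k≡ = cong₂ _,_ (cong +_ (sym (ℕ.+-identityʳ i)))
                                 (cong +_ (trans k≡ (ℕ.+-comm 1 (toℕ j))))

  move-down : ∀ {i j k} → toℕ j ≡ suc (toℕ k) → Move (0ℤ , -1ℤ) (point i j) (point i k)
  move-down {i} j≡ rewrite j≡ = cong (λ x → + x , _) (sym (ℕ.+-identityʳ i))

  move-right : ∀ {i j} → Move (1ℤ , 0ℤ) (point i j) (point (suc i) j)
  move-right {i} {j} = cong₂ _,_ (cong +_ (ℕ.+-comm 1 i)) (cong +_ (sym (ℕ.+-identityʳ (toℕ j))))

  vertical⁺ : ∀ {i j k} → Adjacent i j k → Vertical t (point i j) (point i k)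
  vertical⁺ {i} {j} {k} a = join t refl (split a)
    where
    split : Adjacent i j k →
      (WireParity t (i ℕ.+ toℕ j) × Move (0ℤ , 1ℤ) (point i j) (point i k)) ⊎
      (WireParity (opposite t) (i ℕ.+ toℕ j) × Move (0ℤ , -1ℤ) (point i j) (point i k))
    split (inj₁ (k≡ , q)) = inj₁ (q , move-up k≡)
    -- A wire is indexed by its lower end, here `k`; at the upper end `j` the parity is the opposite
    -- one, as a downward step requires.
    split (inj₂ (j≡ , q)) = inj₂
      ( subst (WireParity (opposite t)) (sym (trans (cong (i ℕ.+_) j≡) (ℕ.+-suc i (toℕ k))))
          (wireParity-suc⁺ t _ q)
      , move-down j≡ )

    join : ∀ s {P P′ n} → n ≡ ℤ.∣ proj₁ P ∣ ℕ.+ ℤ.∣ proj₂ P ∣ →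
      (WireParity s n × Move (0ℤ , 1ℤ) P P′) ⊎ (WireParity (opposite s) n × Move (0ℤ , -1ℤ) P P′) →
      Vertical s P P′
    join type1 refl v = v
    join type2 refl v = v

  vertical-cases : ∀ s {a b P′} → Vertical s (a , b) P′ →
    (WireParity s (ℤ.∣ a ∣ ℕ.+ ℤ.∣ b ∣) × Move (0ℤ , 1ℤ) (a , b) P′) ⊎
    (WireParity (opposite s) (ℤ.∣ a ∣ ℕ.+ ℤ.∣ b ∣) × Move (0ℤ , -1ℤ) (a , b) P′)
  vertical-cases type1 v = v
  vertical-cases type2 v = v

  vertical-abscissa : ∀ {P P′} → Vertical t P P′ → proj₁ P′ ≡ proj₁ P
  vertical-abscissa v with vertical-cases t v
  ... | inj₁ (_ , refl) = ℤ.+-identityʳ _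
  ... | inj₂ (_ , refl) = ℤ.+-identityʳ _

  vertical⁻ : ∀ {l i j P} → Vertical t (point i j) P → InRectangle l w P →
              ∃[ k ] P ≡ point i k × Adjacent i j k
  vertical⁻ {l} {i} {j} v r with vertical-cases t v
  vertical⁻ {l} {i} {j} v (_ , _ , ℤ.+≤+ j+1≤) | inj₁ (q , refl) =
    k , cong₂ _,_ (cong +_ (ℕ.+-identityʳ i)) (cong +_ (sym k≡)) ,
    inj₁ (trans k≡ (ℕ.+-comm (toℕ j) 1) , q)
    where
    k : Fin w
    k = fromℕ< (≤∸1⇒< j j+1≤)

    k≡ : toℕ k ≡ toℕ j ℕ.+ 1
    k≡ = Fin.toℕ-fromℕ< _
  vertical⁻ {l} {i} {j = suc j} v r | inj₂ (q , refl) =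
    Fin.inject₁ j ,
    cong₂ _,_ (cong +_ (ℕ.+-identityʳ i)) (cong +_ (sym (Fin.toℕ-inject₁ j))) ,
    inj₂ (cong suc (sym (Fin.toℕ-inject₁ j)) ,
          wireParity-suc⁻ t _ (subst (WireParity (opposite t))
            (trans (ℕ.+-suc i (toℕ j)) (cong (λ m → suc (i ℕ.+ m)) (sym (Fin.toℕ-inject₁ j)))) q))
  -- From height 0 the step would lead to height -1, outside the rectangle.
  vertical⁻ {j = zero} v (_ , () , _) | inj₂ (q , refl)

  -- Trace i j js ps: the path ps enters column i at height j and leaves
  -- columns i, i+1, … at the heights js.
  data Trace : ℕ → Fin w → ∀ {n} → Vec (Fin w) n → List Point → Set where
    done     : ∀ {i j} → Trace i j [] []
    straight : ∀ {i j n} {js : Vec (Fin w) n} {ps} →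
               Trace (suc i) j js ps → Trace i j (j ∷ js) (point i j ∷ ps)
    bent     : ∀ {i j k n} {js : Vec (Fin w) n} {ps} → Adjacent i j k →
               Trace (suc i) k js ps → Trace i j (k ∷ js) (point i j ∷ point i k ∷ ps)

  -- Entry and exit heights decide the shape of each column: no wire is a loop, so equal heights
  -- exclude a bend.
  trace-functional : ∀ {i j n} {js : Vec (Fin w) n} {ps ps′} →
                     Trace i j js ps → Trace i j js ps′ → ps ≡ ps′
  trace-functional done         done           = refl
  trace-functional (straight a) (straight b)   = cong (_ ∷_) (trace-functional a b)
  trace-functional (straight _) (bent q _)     = contradiction q (adjacent-irrefl _)
  trace-functional (bent q _)   (straight _)   = contradiction q (adjacent-irrefl _)
  trace-functional (bent _ a)   (bent _ b)     = cong (λ ps → _ ∷ _ ∷ ps) (trace-functional a b)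

  trace-injective : ∀ {i j n} {js js′ : Vec (Fin w) n} {ps ps′} → ps ≡ ps′ →
                    Trace i j js ps → Trace i j js′ ps′ → js ≡ js′
  trace-injective _  done         done         = refl
  trace-injective eq (straight a) (straight b) = cong (_ ∷_) (trace-injective (∷-injectiveʳ eq) a b)
  trace-injective eq (bent {i} {k = k} _ a) (bent {k = k′} _ b)
    with Q≡ , ps≡ ← ∷-injective (∷-injectiveʳ eq)
    with refl ← point-injectiveʳ {i} {i} {k} {k′} Q≡ = cong (k ∷_) (trace-injective ps≡ a b)
  -- A straight column is followed by nothing or by a point further right, a bent one by a second
  -- point of the same column. Splitting the remaining trace exposes the clash.
  trace-injective () (straight done)         (bent _ _)
  trace-injective () (straight (straight _)) (bent _ _)
  trace-injective () (straight (bent _ _))   (bent _ _)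
  trace-injective () (bent _ _) (straight done)
  trace-injective () (bent _ _) (straight (straight _))
  trace-injective () (bent _ _) (straight (bent _ _))

  -- Locating the points by column gives both non-repetition across columns and containment in the
  -- rectangle.
  trace-points : ∀ {i j n} {js : Vec (Fin w) n} {ps} → Trace i j js ps →
                 All (λ P → ∃[ m ] ∃[ k ] P ≡ point m k × i ≤ m × m < i ℕ.+ n) ps
  trace-points done = []
  trace-points {i} {n = suc n} (straight {j = j} tr) =
    (i , j , refl , ℕ.≤-refl , ℕ.m<m+n i (s≤s z≤n)) ∷
    All.map (λ (m , k , eq , lo , hi) → m , k , eq , ℕ.<⇒≤ lo ,
               subst (m <_) (sym (ℕ.+-suc i n)) hi) (trace-points tr)
  trace-points {i} {n = suc n} (bent {j = j} {k = k} _ tr) =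
    (i , j , refl , ℕ.≤-refl , ℕ.m<m+n i (s≤s z≤n)) ∷
    (i , k , refl , ℕ.≤-refl , ℕ.m<m+n i (s≤s z≤n)) ∷
    All.map (λ (m , k , eq , lo , hi) → m , k , eq , ℕ.<⇒≤ lo ,
               subst (m <_) (sym (ℕ.+-suc i n)) hi) (trace-points tr)

  fresh : ∀ {h j k n} {js : Vec (Fin w) n} {ps} → Trace (suc h) k js ps →
          All (point h j ≢_) ps
  fresh tr = All.map (λ { (_ , _ , refl , h<m , _) eq →
    ℕ.<⇒≢ h<m (ℤ.+-injective (,-injectiveˡ eq)) }) (trace-points tr)

  trace-unique : ∀ {h j n} {js : Vec (Fin w) n} {ps} → Trace (suc h) j js ps →
                 Unique (point h j ∷ ps)
  trace-unique done            = [] ∷ []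
  trace-unique (straight tr)   = fresh (straight tr) ∷ trace-unique tr
  trace-unique (bent a tr)     =
    fresh (bent a tr) ∷
    ((λ eq → adjacent-irrefl _ (subst (Adjacent _ _) (sym (point-injectiveʳ eq)) a)) ∷ fresh tr) ∷
    trace-unique tr

  -- Bundles both link conditions of a crossing, so that one induction along the trace proves them.
  Link : Point → Point → Set
  Link P P′ = Step t P P′ × ¬ (proj₁ P ≡ 0ℤ × Vertical t P P′)

  link-right : ∀ {h j} → Link (point h j) (point (suc h) j)
  link-right = inj₁ move-right , λ (_ , v) →
    ℕ.1+n≢n (ℤ.+-injective (vertical-abscissa v))

  trace-linked : ∀ {h j n} {js : Vec (Fin w) n} {ps} → Trace (suc h) j js ps →
                 Linked Link (point h j ∷ ps)
  trace-linked done          = [-]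
  trace-linked (straight tr) = link-right ∷ trace-linked tr
  -- The vertical step lies in column `suc h`, whose abscissa is not 0.
  trace-linked (bent a tr)   = link-right ∷ (inj₂ (vertical⁺ a) , λ ()) ∷ trace-linked tr

  trace-last : ∀ {h j n} {js : Vec (Fin w) n} {ps} → Trace (suc h) j js ps →
               ∃[ β ] last (point h j ∷ ps) ≡ just (point (h ℕ.+ n) β)
  trace-last {h} {j} done = j , cong (λ m → just (point m j)) (sym (ℕ.+-identityʳ h))
  trace-last {h} {n = suc n} (straight tr) with β , eq ← trace-last tr =
    β , trans eq (cong (λ m → just (point m β)) (sym (ℕ.+-suc h n)))
  trace-last {h} {n = suc n} (bent _ tr) with β , eq ← trace-last tr =
    β , trans eq (cong (λ m → just (point m β)) (sym (ℕ.+-suc h n)))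

  trace⇒crossing : ∀ {l j} {js : Vec (Fin w) l} {ps} → Trace 1 j js ps →
                   IsCrossing t (suc l) w (point 0 j ∷ ps)
  trace⇒crossing {l} {j} {ps = ps} tr =
    (Linked.map proj₁ links , trace-unique tr) ,
    (j , refl) , trace-last tr ,
    inRectangle z≤n ∷
      All.map (λ { (m , k , refl , _ , m≤l) → inRectangle (ℕ.≤-pred m≤l) }) (trace-points tr) ,
    Linked.map proj₂ links
    where
    links : Linked Link (point 0 j ∷ ps)
    links = trace-linked tr

    inRectangle : ∀ {m k} → m ≤ l → InRectangle (suc l) w (point m k)
    inRectangle {k = k} m≤l =
      (ℤ.+≤+ z≤n , ℤ.+≤+ m≤l) , (ℤ.+≤+ z≤n , ℤ.+≤+ (ℕ.<⇒≤pred (Fin.toℕ<n k)))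

  -- The only partner of `k` is `j`, so a vertical step from `point i k` would revisit `point i j`.
  no-return : ∀ {l i j k R rs} → Adjacent i j k → All (point i j ≢_) (R ∷ rs) →
              All (InRectangle l w) (R ∷ rs) → ¬ Vertical t (point i k) R
  no-return {l} {i} a (R≢ ∷ _) (r ∷ _) v with _ , refl , b ← vertical⁻ {l} v r =
    R≢ (cong (point i) (adjacent-functional i (⊎-swap a) b))

  -- (h , j) is the point at which the path leaves column h: this is what the
  -- last hypothesis says.
  departure⇒trace : ∀ {l} h j ps → Linked (Step t) (point h j ∷ ps) → Unique (point h j ∷ ps) →
    All (InRectangle (suc l) w) ps → ∀ {β} → last (point h j ∷ ps) ≡ just (+ l , β) →
    (∀ {P qs} → ps ≡ P ∷ qs → ¬ Vertical t (point h j) P) →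
    ∃[ n ] h ℕ.+ n ≡ l × ∃[ js ] Trace (suc h) j {n} js ps
  departure⇒trace h j [] _ _ _ eq _ =
    0 , trans (ℕ.+-identityʳ h) (ℤ.+-injective (,-injectiveˡ (just-injective eq))) , [] , done
  departure⇒trace h j (P ∷ ps) (inj₂ v ∷ _) _ _ _ ¬v = contradiction v (¬v refl)
  departure⇒trace h j (P ∷ ps) (inj₁ m ∷ lk) (_ ∷ u) (_ ∷ r) eq _
    with refl ← trans m (sym (move-right {h} {j})) = arrive ps lk u r eq
    where
    arrive : ∀ {l} ps → Linked (Step t) (point (suc h) j ∷ ps) → Unique (point (suc h) j ∷ ps) →
      All (InRectangle (suc l) w) ps → ∀ {β} → last (point (suc h) j ∷ ps) ≡ just (+ l , β) →
      ∃[ n ] h ℕ.+ n ≡ l × ∃[ js ] Trace (suc h) j {n} js (point (suc h) j ∷ ps)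
    go-straight : ∀ {l} ps → Linked (Step t) (point (suc h) j ∷ ps) →
      Unique (point (suc h) j ∷ ps) → All (InRectangle (suc l) w) ps → ∀ {β} → last (point (suc h) j ∷ ps) ≡ just (+ l , β) →
      (∀ {P qs} → ps ≡ P ∷ qs → ¬ Vertical t (point (suc h) j) P) →
      ∃[ n ] h ℕ.+ n ≡ l × ∃[ js ] Trace (suc h) j {n} js (point (suc h) j ∷ ps)
    go-straight ps lk u r eq ¬v with n , n≡ , js , tr ← departure⇒trace (suc h) j ps lk u r eq ¬v =
      suc n , trans (ℕ.+-suc h n) n≡ , j ∷ js , straight tr

    arrive [] lk u r eq = go-straight [] lk u r eq λ ()
    arrive (Q ∷ qs) lk u r eq with vertical? t (point (suc h) j) Q
    ... | no ¬v = go-straight (Q ∷ qs) lk u r eq λ { refl → ¬v }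
    arrive {l} (Q ∷ qs) (_ ∷ lk) ((_ ∷ j∉) ∷ u) (q ∷ r) eq | yes v
      with k , refl , a ← vertical⁻ {suc l} v q
      -- After one vertical step the path must leave the column, by `no-return`; this provides the
      -- departure hypothesis at height `k`.
      with n , n≡ , js , tr ← departure⇒trace (suc h) k qs lk u r eq
             (λ { refl v′ → no-return {suc l} a j∉ r v′ }) =
      suc n , trans (ℕ.+-suc h n) n≡ , k ∷ js , bent a tr

  -- The ban on vertical steps along x = 0 means that column 0 is left at its starting height, which
  -- is the departure hypothesis that starts the induction.
  crossing⇒trace : ∀ {l ps} → IsCrossing t (suc l) w ps →
    ∃[ j ] ∃[ js ] ∃[ ps′ ] ps ≡ point 0 j ∷ ps′ × Trace 1 j {l} js ps′
  crossing⇒trace {l} {P ∷ ps} ((lk , u) , (j , refl) , (_ , eq) , (_ ∷ r) , ¬v)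
    with n , refl , js , tr ← departure⇒trace 0 j ps lk u r eq
           (λ { refl v → Linked.head ¬v (refl , v) }) =
    j , js , ps , refl , tr

-- Closed configurations

module Network (t : NetworkType) (l w : ℕ) where

  open Hammock t l w
  open Wires t {w}

  Selects : (Fin l → Fin w) → Configuration → Set
  Selects s X = (∀ c → relay c (s c) Subset.∈ X) × (∀ {c j} → relay c j Subset.∈ X → j ≡ s c)

  selects-⊆ : ∀ {s X X′} → Selects s X → Selects s X′ → X Subset.⊆ X′
  selects-⊆ (_ , unique) (selected , _) {r} r∈
    with j , c , refl ← Fin.combine-surjective {w} {l} r
    with refl ← unique {c} {j} r∈ = selected c

  selects-injective : ∀ {s X X′} → Selects s X → Selects s X′ → X ≡ X′
  selects-injective {s} a b = SubsetProperties.⊆-antisym (selects-⊆ {s} a b) (selects-⊆ {s} b a)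

  selection : (s : Fin l → Fin w) → ∃[ X ] Selects s X
  selection s = X , (λ c → ∈X⁺ refl) , ∈X⁻
    where
    Q? : ∀ r → Dec (proj₁ (remQuot {w} l r) ≡ s (proj₂ (remQuot {w} l r)))
    Q? r = _ Fin.≟ _

    X : Configuration
    X = tabulate (does ∘ Q?)

    ∈X⁺ : ∀ {c j} → j ≡ s c → relay c j Subset.∈ X
    ∈X⁺ {c} {j} j≡ = Vec.lookup⇒[]= (relay c j) X (trans (Vec.lookup∘tabulate _ (relay c j))
      (dec-true (Q? (relay c j))
        (subst (λ (j′ , c′) → j′ ≡ s c′) (sym (Fin.remQuot-combine j c)) j≡)))

    ∈X⁻ : ∀ {c j} → relay c j Subset.∈ X → j ≡ s c
    ∈X⁻ {c} {j} r∈ = subst (λ (j′ , c′) → j′ ≡ s c′) (Fin.remQuot-combine j c) holds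
      where
      holds : proj₁ (remQuot {w} l (relay c j)) ≡ s (proj₂ (remQuot {w} l (relay c j)))
      -- The second scrutinee states that the decision at this position is `true`, which rules out
      -- `no`.
      holds with Q? (relay c j)
               | trans (sym (Vec.lookup∘tabulate (does ∘ Q?) (relay c j))) (Vec.[]=⇒lookup r∈)
      ... | yes q | _ = q

  relay-injective : ∀ {c c′ j j′} → relay c j ≡ relay c′ j′ → c ≡ c′ × j ≡ j′
  relay-injective eq = swap (Fin.combine-injective _ _ _ _ eq)

  size-≥ : ∀ {rs} {X : Configuration} → Unique rs → All (Subset._∈ X) rs → length rs ≤ Subset.∣ X ∣
  size-≥ {rs} {X} u a = subst (length rs ≤_) (length-members X)
    (unique-length (members X) u (All.map ∈-members⁺ a))

  selectedRelays : (Fin l → Fin w) → List (Fin (w * l))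
  selectedRelays s = map (λ c → relay c (s c)) (allFin l)

  length-selectedRelays : ∀ s → length (selectedRelays s) ≡ l
  length-selectedRelays s = trans (length-map _ (allFin l)) (length-tabulate id)

  selectedRelays-unique : ∀ s → Unique (selectedRelays s)
  selectedRelays-unique s = Unique.map⁺ (proj₁ ∘ relay-injective) (Unique.allFin⁺ l)

  selectedRelays-⊆ : ∀ {s X} → (∀ c → relay c (s c) Subset.∈ X) →
                     All (Subset._∈ X) (selectedRelays s)
  selectedRelays-⊆ s∈ = All.map⁺ (All.tabulate λ {c} _ → s∈ c)

  l≤size : ∀ {s X} → (∀ c → relay c (s c) Subset.∈ X) → l ≤ Subset.∣ X ∣
  l≤size {s} s∈ = subst (_≤ _) (length-selectedRelays s)
    (size-≥ (selectedRelays-unique s) (selectedRelays-⊆ s∈))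

  -- A closed relay off the selection would make `l` + 1 distinct closed relays.
  size≡l⇒unique : ∀ {s X} → (∀ c → relay c (s c) Subset.∈ X) → Subset.∣ X ∣ ≡ l →
                  ∀ {c j} → relay c j Subset.∈ X → j ≡ s c
  size≡l⇒unique {s} {X} s∈ size {c} {j} r∈ with j Fin.≟ s c
  ... | yes j≡ = j≡
  ... | no  j≢ = contradiction
    (ℕ.≤-trans
      (ℕ.≤-reflexive (cong suc (sym (length-selectedRelays s))))
      (size-≥ (All.map⁺ (All.tabulate λ _ eq → new (relay-injective eq)) ∷ selectedRelays-unique s)
              (r∈ ∷ selectedRelays-⊆ s∈)))
    (ℕ.<⇒≱ (s≤s (ℕ.≤-reflexive size)))
    where
    new : ∀ {c′} → ¬ (c ≡ c′ × j ≡ s c′)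
    new (refl , j≡) = j≢ j≡

  selects⇒size : ∀ {s X} → Selects s X → Subset.∣ X ∣ ≡ l
  selects⇒size {s} {X} (s∈ , unique) = ℕ.≤-antisym
    (ℕ.≤-trans (ℕ.≤-reflexive (sym (length-members X)))
      (ℕ.≤-trans (unique-length (selectedRelays s) (members-unique X) (All.tabulate member))
                 (ℕ.≤-reflexive (length-selectedRelays s))))
    (l≤size s∈)
    where
    member : ∀ {r} → r ∈ members X → r ∈ selectedRelays s
    member {r} r∈ with j , c , refl ← Fin.combine-surjective {w} {l} r
      with refl ← unique {c} {j} (∈-members⁻ r∈) = ∈-map⁺ _ (∈-allFin c)

  -- The cut principle: a `Side` respected by every join, true at `S` and false at `T`, shows that
  -- the network is open.
  invariant : ∀ {X} (Side : End → Set) →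
              (∀ {u v} → Joined X u v → (Side u → Side v) × (Side v → Side u)) →
              ∀ {u v} → EqClosure (Joined X) u v → Side u → Side v
  invariant Side step ε           = id
  invariant Side step (fwd e ◅ c) = invariant Side step c ∘ proj₁ (step e)
  invariant Side step (bwd e ◅ c) = invariant Side step c ∘ proj₂ (step e)

  -- The cut consists of the relays of column `c`: if all are open, the ends to their left are
  -- separated from those to their right.
  column-closed : ∀ {X} → Closed X → ∀ c → ∃[ j ] relay c j Subset.∈ X
  column-closed {X} closedX c with Fin.any? (λ j → relay c j SubsetProperties.∈? X)
  ... | yes found = found
  ... | no  none  = contradiction tt (invariant Side step closedX)
    where
    Side : End → Set
    Side S           = ⊤
    Side T           = ⊥
    Side (left i j)  = toℕ i ≤ toℕ c
    Side (right i j) = toℕ i < toℕ c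

    step : ∀ {u v} → Joined X u v → (Side u → Side v) × (Side v → Side u)
    step (source i≡0)  = (λ _ → ℕ.≤-trans (ℕ.≤-reflexive i≡0) z≤n) , λ _ → tt
    step (sink i≡l)    =
      (λ i<c → ℕ.<⇒≱ (Fin.toℕ<n c) (ℕ.≤-trans (ℕ.≤-reflexive (sym i≡l)) i<c)) , λ ()
    step (node i′≡)    = subst (_≤ toℕ c) (sym i′≡) , subst (_≤ toℕ c) i′≡
    step (wire _ _ _)  = id , id
    step (closed {i} {j} r∈) =
      (λ i≤c → ℕ.≤∧≢⇒< i≤c λ i≡c →
        none (j , subst (λ i → relay i j Subset.∈ X) (Fin.toℕ-injective i≡c) r∈)) ,
      ℕ.<⇒≤

  closed⇒l≤size : ∀ {X} → Closed X → l ≤ Subset.∣ X ∣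
  closed⇒l≤size c = l≤size {proj₁ ∘ column-closed c} (proj₂ ∘ column-closed c)

  -- Otherwise everything left of the relays of column `c`, with the wire component of the node
  -- right after height `s c`, would be cut off: the one relay of column `c′` that may be closed
  -- starts outside that component.
  consecutive-near : ∀ {s X} → Closed X → (∀ {c j} → relay c j Subset.∈ X → j ≡ s c) →
                     ∀ c c′ → toℕ c′ ≡ suc (toℕ c) → Near (toℕ c′) (s c) (s c′)
  consecutive-near {s} {X} closedX unique c c′ c′≡ with near? (toℕ c′) (s c) (s c′)
  ... | yes near = near
  ... | no ¬near = contradiction tt (invariant Side step closedX)
    where
    NearC : Fin w → Set
    NearC = Near (toℕ c′) (s c)

    Side : End → Set
    Side S           = ⊤
    Side T           = ⊥
    Side (left i j)  = toℕ i ≤ toℕ c ⊎ (toℕ i ≡ suc (toℕ c) × NearC j)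
    Side (right i j) = toℕ i < toℕ c ⊎ (toℕ i ≡ toℕ c × NearC j)

    -- The terminus is joined to the last column only, and `c` is not the last since `c′` follows
    -- it.
    not-last : ∀ {i} → suc i ≡ l → ¬ (i ≤ toℕ c)
    not-last i≡ i≤c = ℕ.<⇒≱ (Fin.toℕ<n c′)
      (ℕ.≤-trans (ℕ.≤-reflexive (sym i≡)) (ℕ.≤-trans (s≤s i≤c) (ℕ.≤-reflexive (sym c′≡))))

    step : ∀ {u v} → Joined X u v → (Side u → Side v) × (Side v → Side u)
    step (source i≡0) = (λ _ → inj₁ (ℕ.≤-trans (ℕ.≤-reflexive i≡0) z≤n)) , λ _ → tt
    step (sink i≡l)   =
      (λ { (inj₁ i<c) → not-last i≡l (ℕ.<⇒≤ i<c)
         ; (inj₂ (i≡c , _)) → not-last i≡l (ℕ.≤-reflexive i≡c) }) ,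
      λ ()
    step (node i′≡)   =
      (λ { (inj₁ i<c) → inj₁ (subst (_≤ toℕ c) (sym i′≡) i<c)
         ; (inj₂ (i≡c , n)) → inj₂ (trans i′≡ (cong suc i≡c) , n) }) ,
      (λ { (inj₁ i′≤c) → inj₁ (subst (_≤ toℕ c) i′≡ i′≤c)
         ; (inj₂ (i′≡c , n)) → inj₂ (ℕ.suc-injective (trans (sym i′≡) i′≡c) , n) })
    step (wire {i} {j} {j′} _ j′≡ q) =
      (λ { (inj₁ i≤c) → inj₁ i≤c
         ; (inj₂ (i≡ , n)) → inj₂ (i≡ , near-adjacent (toℕ c′) n (inj₁ (wired i≡))) }) ,
      (λ { (inj₁ i≤c) → inj₁ i≤c
         ; (inj₂ (i≡ , n)) → inj₂ (i≡ , near-adjacent (toℕ c′) n (inj₂ (wired i≡))) })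
      where
      wired : toℕ i ≡ suc (toℕ c) → Wired (toℕ c′) j j′
      wired i≡ = j′≡ , subst (λ m → WireParity t (m ℕ.+ toℕ j)) (trans i≡ (sym c′≡)) q
    step (closed {i} {j} r∈) = forth ,
      λ { (inj₁ i<c) → inj₁ (ℕ.<⇒≤ i<c) ; (inj₂ (i≡c , _)) → inj₁ (ℕ.≤-reflexive i≡c) }
      where
      forth : Side (left i j) → Side (right i j)
      forth (inj₁ i≤c) with toℕ i ℕ.≟ toℕ c
      ... | no  i≢c = inj₁ (ℕ.≤∧≢⇒< i≤c i≢c)
      ... | yes i≡c = inj₂ (i≡c , inj₁
        (trans (cong s (Fin.toℕ-injective (sym i≡c))) (sym (unique r∈))))
      forth (inj₂ (i≡ , n)) = contradiction
        (subst NearC (trans (unique r∈) (cong s (Fin.toℕ-injective (trans i≡ (sym c′≡))))) n) ¬near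

-- The correspondence between closed configurations of minimal size and crossings

module Bijection (t : NetworkType) (l w : ℕ) where

  open Hammock t (suc l) w
  open Wires t {w}
  open Network t (suc l) w
  open Paths t w

  -- The offset `h` is the number of the column of `s zero`; it keeps the wire parities correct
  -- while the recursion drops columns.
  near⇒trace : ∀ {n} h (s : Fin (suc n) → Fin w) →
    (∀ c c′ → toℕ c′ ≡ suc (toℕ c) → Near (h ℕ.+ toℕ c′) (s c) (s c′)) →
    ∃[ ps ] Trace (suc h) (s zero) (tabulate (s ∘ suc)) ps
  near⇒trace {zero}  h s near = [] , done
  near⇒trace {suc n} h s near
    with ps , tr ← near⇒trace (suc h) (s ∘ suc)
           (λ c c′ c′≡ → subst (λ m → Near m (s (suc c)) (s (suc c′))) (ℕ.+-suc h (toℕ c′))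
             (near (suc c) (suc c′) (cong suc c′≡)))
    with near zero (suc zero) refl
  ... | inj₁ eq = _ ,
    subst (λ j → Trace (suc h) j (tabulate (s ∘ suc)) (point (suc h) (s (suc zero)) ∷ ps)) (sym eq)
      (straight tr)
  ... | inj₂ a  = _ ,
    bent (subst (λ m → Adjacent m (s zero) (s (suc zero))) (ℕ.+-comm h 1) a) tr

  -- The trace is followed to `T`: each column gives a node, a wire at a bend, and the closed relay
  -- at the exit height. The equation `h + n ≡ l` makes the trace end at the last column.
  trace⇒connected : ∀ {X h j n} {js : Vec (Fin w) n} {ps} → Trace (suc h) j js ps → h ℕ.+ n ≡ l →
    (∀ c m → toℕ c ≡ suc h ℕ.+ toℕ m → relay c (lookup js m) Subset.∈ X) →
    ∀ c → toℕ c ≡ h → EqClosure (Joined X) (right c j) T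
  trace⇒connected {h = h} done h≡ _ c c≡ =
    fwd (sink (cong suc (trans c≡ (trans (sym (ℕ.+-identityʳ h)) h≡)))) ◅ ε
  trace⇒connected {X} {h} {j} {suc n} {k ∷ js} tr h≡ js∈ c c≡ = through tr
    where
    c′< : suc h < suc l
    c′< = s≤s (ℕ.≤-trans (ℕ.m<m+n h (s≤s z≤n)) (ℕ.≤-reflexive h≡))

    c′ : Fin (suc l)
    c′ = fromℕ< c′<

    c′≡ : toℕ c′ ≡ suc h
    c′≡ = Fin.toℕ-fromℕ< c′<

    rest : ∀ {ps} → Trace (suc (suc h)) k js ps → EqClosure (Joined X) (left c′ k) T
    rest tr = fwd (closed (js∈ c′ zero (trans c′≡ (sym (ℕ.+-identityʳ (suc h)))))) ◅
      trace⇒connected tr (trans (sym (ℕ.+-suc h n)) h≡)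
        (λ c m c≡ → js∈ c (suc m) (trans c≡ (sym (ℕ.+-suc (suc h) (toℕ m))))) c′ c′≡

    1≤c′ : 1 ≤ toℕ c′
    1≤c′ = ℕ.≤-trans (s≤s z≤n) (ℕ.≤-reflexive (sym c′≡))

    enter : ∀ {j} → Joined X (right c j) (left c′ j)
    enter = node (trans c′≡ (cong suc (sym c≡)))

    through : ∀ {ps} → Trace (suc h) j (k ∷ js) ps → EqClosure (Joined X) (right c j) T
    through (straight tr) = fwd enter ◅ rest tr
    through (bent (inj₁ (k≡ , q)) tr) =
      fwd enter ◅
      fwd (wire 1≤c′ k≡ (subst (λ m → WireParity t (m ℕ.+ toℕ j)) (sym c′≡) q)) ◅
      rest tr
    -- The wire is indexed by its lower end, now `k`, so it is run through backwards.
    through (bent (inj₂ (j≡ , q)) tr) =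
      fwd enter ◅
      bwd (wire 1≤c′ j≡ (subst (λ m → WireParity t (m ℕ.+ toℕ k)) (sym c′≡) q)) ◅
      rest tr

  -- The heights `j ∷ js` link both sides: `j`, the start of the path, is the height of the closed
  -- relay in column 0, and `js` are the exit heights from column 1 on.
  Corresponds : Configuration → List Point → Set
  Corresponds X ps = ∃[ j ] ∃[ js ] ∃[ ps′ ]
    ps ≡ point 0 j ∷ ps′ × Trace 1 j {l} js ps′ × Selects (lookup (j ∷ js)) X

  closed⇒crossing : ∀ {X} → Subset.∣ X ∣ ≡ suc l × Closed X →
                    ∃[ ps ] IsCrossing t (suc l) w ps × Corresponds X ps
  closed⇒crossing {X} (size , closedX)
    with ps , tr ← near⇒trace 0 (λ c → proj₁ (column-closed closedX c))
           (consecutive-near closedX (size≡l⇒unique (λ c → proj₂ (column-closed closedX c)) size)) =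
    _ , trace⇒crossing tr , _ , _ , _ , refl , tr ,
    (λ c → subst (λ j → relay c j Subset.∈ X) (sym (Vec.lookup∘tabulate s c)) (s∈ c)) ,
    (λ {c} r∈ → trans (size≡l⇒unique s∈ size r∈) (sym (Vec.lookup∘tabulate s c)))
    where
    s : Fin (suc l) → Fin w
    s c = proj₁ (column-closed closedX c)

    s∈ : ∀ c → relay c (s c) Subset.∈ X
    s∈ c = proj₂ (column-closed closedX c)

  crossing⇒closed : ∀ {ps} → IsCrossing t (suc l) w ps →
                    ∃[ X ] (Subset.∣ X ∣ ≡ suc l × Closed X) × Corresponds X ps
  crossing⇒closed cr with j , js , ps , eq , tr ← crossing⇒trace cr
    with X , sel@(s∈ , _) ← selection (lookup (j ∷ js)) =
    X , (selects⇒size {lookup (j ∷ js)} sel ,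
         fwd (source {i = zero} {j} refl) ◅ fwd (closed (s∈ zero)) ◅
         trace⇒connected tr refl
           (λ c m c≡ → subst (λ c → relay c (lookup js m) Subset.∈ X)
                         (Fin.toℕ-injective (sym c≡)) (s∈ (suc m)))
           zero refl) ,
    j , js , ps , eq , tr , sel

  corresponds-functional : ∀ {X ps ps′} → Corresponds X ps → Corresponds X ps′ → ps ≡ ps′
  corresponds-functional (j , js , _ , refl , tr , s∈ , _) (j′ , js′ , _ , refl , tr′ , _ , unique)
    -- Both height vectors are read off the closed relays of the same `X`, hence agree.
    with refl ← trans (sym (Vec.tabulate∘lookup (j ∷ js)))
               (trans (Vec.tabulate-cong (λ c → unique (s∈ c))) (Vec.tabulate∘lookup (j′ ∷ js′))) =
    cong (point 0 j ∷_) (trace-functional tr tr′)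

  corresponds-injective : ∀ {X X′ ps} → Corresponds X ps → Corresponds X′ ps → X ≡ X′
  corresponds-injective (j , js , ps , eq , tr , sel) (j′ , js′ , ps′ , eq′ , tr′ , sel′)
    with heads , tails ← ∷-injective (trans (sym eq) eq′)
    with refl ← point-injectiveʳ {0} {0} {j} {j′} heads
    with refl ← trace-injective tails tr tr′ = selects-injective {lookup (j ∷ js)} sel sel′

  -- The relation `Corresponds` is total and injective from either side, so it gives both
  -- inequalities.
  Nₗ≡𝓑 : N (suc l) ≡ 𝓑 t (suc l) w
  Nₗ≡𝓑 = ℕ.≤-antisym
    (card-≤-relation F (crossings t (suc l) w) Corresponds closed⇒crossing corresponds-injective)
    (card-≤-relation (crossings t (suc l) w) F (λ ps X → Corresponds X ps)
       crossing⇒closed corresponds-functional)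
    where
    F : Finite (λ X → Subset.∣ X ∣ ≡ suc l × Closed X)
    F = finiteSubsets _

mainTheorem5 : (l w : ℕ) → 2 ≤ l → 2 ≤ w → (t : NetworkType) →
  let h = reliability t l w
      N = Hammock.N t l w
      P = coeff h
  in (h ≈ ∑[ l ≤k≤ w * l ] (λ k → + N k · p ^ k ⊗ 1-p ^ (w * l ∸ k)))
   × (h ≈ ∑[ l ≤k≤ w * l ] (λ k → P k · p ^ k))
   × (P l ≡ + N l)
   × (N l ≡ 𝓑 t l w)
mainTheorem5 (suc zero) _ (s≤s ()) _ _
mainTheorem5 (suc (suc _)) (suc zero) _ (s≤s ()) _
mainTheorem5 (suc (suc l)) (suc (suc w)) _ _ t =
  h≈∑N , h≈∑P , Pₗ≡Nₗ , Bijection.Nₗ≡𝓑 t (suc l) (suc (suc w))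
  where
  open FirstCoefficient t (suc (suc l)) (suc (suc w))
    -- As the width is a successor, the product unfolds to the length plus a remainder, whence the
    -- second hypothesis.
    (Network.closed⇒l≤size t _ _) (ℕ.m≤m+n _ (suc w * suc (suc l)))
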